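{- Let $m,\ell\in\mathbb{N}$. There is a $3$-coloring of $\mathbb{N}$ such that, for every infinite $B\subseteq\mathbb{N}$ and every $t\in\mathbb{Z}$, the set $$\{(m+\ell)x:x\in B\}\cup\{mx+\ell y+t:x,y\in B,\ x<y\},$$ whenever it is contained in $\mathbb{N}$, is not monochromatic.
   Context: $\mathbb{N}=\{1,2,3,\ldots\}$. An $r$-coloring of a set $S$ is a map from $S$ to a set with $r$ elements; a subset of $S$ is monochromatic if the coloring is constant on it. The coloring may depend on $m,\ell$ but not on $B$ or $t$. -}

module Defs where

open import Data.Fin.Base using (Fin)
open import Data.Integer.Base as ℤ using (ℤ; +_)
open import Data.Nat.Base using (ℕ; NonZero; _<_)
import Data.Nat.Base as ℕ
open import Data.Product.Base using (∃-syntax; _×_)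
open import Level using (0ℓ)
open import Relation.Binary.PropositionalEquality.Core using (_≡_)
open import Relation.Unary using (Pred; _∪_)

-- The set being coloured is {1,2,3,…}, so 0 receives no colour.
Coloring : ℕ → Set
Coloring r = (n : ℕ) → .{{NonZero n}} → Fin r

-- A is a set of integers because the patterns below involve an integer
-- shift; this is only meant for A contained in the positive integers.
Monochromatic : ∀ {r} → Coloring r → Pred ℤ 0ℓ → Set
Monochromatic χ A =
  ∀ i j .{{_ : NonZero i}} .{{_ : NonZero j}} → A (+ i) → A (+ j) → χ i ≡ χ j

Dilate : ℕ → Pred ℕ 0ℓ → Pred ℤ 0ℓ
Dilate k B z = ∃[ x ] (B x × z ≡ + (k ℕ.* x))

OrderedSums : ℕ → ℕ → Pred ℕ 0ℓ → ℤ → Pred ℤ 0ℓ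
OrderedSums m ℓ B t z =
  ∃[ x ] ∃[ y ] (B x × B y × x < y × z ≡ + (m ℕ.* x ℕ.+ ℓ ℕ.* y) ℤ.+ t)

Pattern : ℕ → ℕ → Pred ℕ 0ℓ → ℤ → Pred ℤ 0ℓ
Pattern m ℓ B t = Dilate (m ℕ.+ ℓ) B ∪ OrderedSums m ℓ B t

{-# OPTIONS --safe #-}
module Submission where

-- Only one pair of elements of the pattern is needed.  Fix x in B and let y
-- run through B.  The pattern contains N = (m + ℓ) y and n = m x + ℓ y + t, and
-- N / n tends to ρ = (m + ℓ) / ℓ > 1 as y grows, whatever x and t are.
--
-- Cut ℕ into consecutive intervals whose endpoints grow like β^i, where
-- β = (1 + ρ) / 2 = (2 ℓ + m) / (2 ℓ), and colour a number by the index of its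
-- interval modulo 3.  Since 1 < β < ρ < β², for y large the number N is too
-- large to lie in the interval of n or below it, and too small to lie three or
-- more intervals above it: the interval indices differ by exactly 1 or 2, so
-- the colours differ (`separated`, `ratio-lower`, `ratio-upper`).
--
-- The strict inequalities β < ρ < β² leave a margin linear in y, which absorbs
-- both the rounding of the endpoints and the bounded error m x + t:
-- (m + ℓ) y exceeds β (ℓ y) by m y / 2, and β² (ℓ y) exceeds (m + ℓ) y by
-- m² y / (4 ℓ).

open import Defs
open import Data.Fin.Base using (toℕ)
open import Data.Fin.Properties using (toℕ-fromℕ<)
open import Data.Integer.Base using (ℤ; Positive; +_; -[1+_])
import Data.Integer.Base as ℤ
import Data.Integer.Properties as ℤ
open import Data.Nat.Base using (ℕ; zero; suc; NonZero; _+_; _*_; _≤_; _<_; z≤n; s≤s; z<s; >-nonZero; >-nonZero⁻¹)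
open import Data.Nat.DivMod using (_/_; _%_; _mod_; m≡m%n+[m/n]*n; m%n<n; m/n*n≤m)
open import Data.Nat.InfinitelyOften using (Inf; witness)
open import Data.Nat.Properties
open import Data.Nat.Tactic.RingSolver using (solve-∀)
open import Data.Product.Base using (Σ-syntax; ∃-syntax; _×_; _,_; proj₁; proj₂)
open import Data.Sum.Base using (inj₁; inj₂)
open import Level using (0ℓ)
open import Relation.Binary.PropositionalEquality using (_≡_; _≢_; refl; sym; trans; cong; subst; module ≡-Reasoning)
open import Relation.Nullary.Decidable.Core using (yes; no)
open import Relation.Nullary.Negation.Core using (¬_)
open import Relation.Unary using (Pred; _⊆_)

-- Residues

mod-≡⇒%-≡ : ∀ i j d .{{_ : NonZero d}} → i mod d ≡ j mod d → i % d ≡ j % d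
mod-≡⇒%-≡ i j d eq = begin
  i % d          ≡⟨ toℕ-fromℕ< (m%n<n i d) ⟨
  toℕ (i mod d)  ≡⟨ cong toℕ eq ⟩
  toℕ (j mod d)  ≡⟨ toℕ-fromℕ< (m%n<n j d) ⟩
  j % d          ∎
  where open ≡-Reasoning

%-≡∧<⇒+≤ : ∀ i j d .{{_ : NonZero d}} → i % d ≡ j % d → i < j → d + i ≤ j
%-≡∧<⇒+≤ i j d eq i<j = begin
  d + i                      ≡⟨ cong (λ k → d + k) (m≡m%n+[m/n]*n i d) ⟩
  d + (i % d + i / d * d)    ≡⟨ rearrange d (i % d) (i / d) ⟩
  i % d + suc (i / d) * d    ≤⟨ +-monoʳ-≤ (i % d) (*-monoˡ-≤ d quotients) ⟩
  i % d + j / d * d          ≡⟨ cong (_+ j / d * d) eq ⟩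
  j % d + j / d * d          ≡⟨ m≡m%n+[m/n]*n j d ⟨
  j                          ∎
  where
  open ≤-Reasoning
  rearrange : ∀ d r q → d + (r + q * d) ≡ r + suc q * d
  rearrange = solve-∀
  quotients : i / d < j / d
  quotients = *-cancelʳ-< d (i / d) (j / d) (+-cancelˡ-< (i % d) _ _ (begin-strict
    i % d + i / d * d  ≡⟨ m≡m%n+[m/n]*n i d ⟨
    i                  <⟨ i<j ⟩
    j                  ≡⟨ m≡m%n+[m/n]*n j d ⟩
    j % d + j / d * d  ≡⟨ cong (_+ j / d * d) eq ⟨
    i % d + j / d * d  ∎))

-- Intervals of geometric growth

module Intervals (e d : ℕ) .{{_ : NonZero d}} where

  open ≤-Reasoning

  -- The left endpoints 0 = a₀ < a₁ < a₂ < … of the intervals.  Each aᵢ₊₁ is the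
  -- least integer greater than β aᵢ, where β = (d + e) / d; starting at 0 makes
  -- the intervals cover ℕ, and gives a₁ = 1.
  endpoint : ℕ → ℕ
  endpoint zero    = 0
  endpoint (suc i) = suc (endpoint i + e * endpoint i / d)

  endpoint-<-suc : ∀ i → endpoint i < endpoint (suc i)
  endpoint-<-suc i = s≤s (m≤m+n (endpoint i) _)

  endpoint-mono : ∀ {i j} → i ≤ j → endpoint i ≤ endpoint j
  endpoint-mono z≤n = z≤n
  endpoint-mono {suc i} {suc j} (s≤s i≤j) with m≤n⇒m<n∨m≡n i≤j
  ... | inj₂ refl = ≤-refl
  ... | inj₁ (s≤s {n = k} i≤k) = ≤-trans (endpoint-mono {suc i} {suc k} (s≤s i≤k)) (<⇒≤ (endpoint-<-suc (suc k)))

  endpoint-suc-lower : ∀ i → (d + e) * endpoint i < d * endpoint (suc i)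
  endpoint-suc-lower i = begin-strict
    (d + e) * a                              ≡⟨ *-distribʳ-+ a d e ⟩
    d * a + e * a                            ≡⟨ cong (λ k → d * a + k) (m≡m%n+[m/n]*n (e * a) d) ⟩
    d * a + (e * a % d + e * a / d * d)      <⟨ +-monoʳ-< (d * a) (+-monoˡ-< _ (m%n<n (e * a) d)) ⟩
    d * a + (d + e * a / d * d)              ≡⟨ rearrange d a (e * a / d) ⟩
    d * suc (a + e * a / d)                  ∎
    where
    a = endpoint i
    rearrange : ∀ d a q → d * a + (d + q * d) ≡ d * suc (a + q)
    rearrange = solve-∀

  endpoint-suc-upper : ∀ i → d * endpoint (suc i) ≤ (d + e) * endpoint i + d
  endpoint-suc-upper i = begin
    d * suc (a + e * a / d)          ≡⟨ rearrange d a (e * a / d) ⟩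
    d * a + e * a / d * d + d        ≤⟨ +-monoˡ-≤ d (+-monoʳ-≤ (d * a) (m/n*n≤m (e * a) d)) ⟩
    d * a + e * a + d                ≡⟨ cong (_+ d) (*-distribʳ-+ a d e) ⟨
    (d + e) * a + d                  ∎
    where
    a = endpoint i
    rearrange : ∀ d a q → d * suc (a + q) ≡ d * a + q * d + d
    rearrange = solve-∀

  locate : ∀ n → ∃[ i ] (endpoint i ≤ n × n < endpoint (suc i))
  locate zero = 0 , z≤n , z<s
  locate (suc n) with locate n
  ... | i , aᵢ≤n , n<aᵢ₊₁ with endpoint (suc i) ≤? suc n
  ...   | no  aᵢ₊₁≰n+1 = i , m≤n⇒m≤1+n aᵢ≤n , ≰⇒> aᵢ₊₁≰n+1
  ...   | yes aᵢ₊₁≤n+1 = suc i , aᵢ₊₁≤n+1 , ≤-<-trans n<aᵢ₊₁ (endpoint-<-suc (suc i))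

  -- The index of the interval containing n: roughly the logarithm of n to
  -- base β.
  level : ℕ → ℕ
  level n = proj₁ (locate n)

  endpoint-level-≤ : ∀ n → endpoint (level n) ≤ n
  endpoint-level-≤ n = proj₁ (proj₂ (locate n))

  <-endpoint-suc-level : ∀ n → n < endpoint (suc (level n))
  <-endpoint-suc-level n = proj₂ (proj₂ (locate n))

  level-≤⇒ratio-< : ∀ {n N} → level N ≤ level n → d * N < (d + e) * n + d
  level-≤⇒ratio-< {n} {N} le = begin-strict
    d * N                                  <⟨ *-monoʳ-< d (<-endpoint-suc-level N) ⟩
    d * endpoint (suc (level N))           ≤⟨ *-monoʳ-≤ d (endpoint-mono (s≤s le)) ⟩
    d * endpoint (suc (level n))           ≤⟨ endpoint-suc-upper (level n) ⟩
    (d + e) * endpoint (level n) + d       ≤⟨ +-monoˡ-≤ d (*-monoʳ-≤ (d + e) (endpoint-level-≤ n)) ⟩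
    (d + e) * n + d                        ∎

  -- Two whole intervals separate n from N, so N exceeds β² n.
  3+level-≤⇒ratio-> : ∀ {n N} → 3 + level n ≤ level N →
                      (d + e) * ((d + e) * n) < d * (d * N)
  3+level-≤⇒ratio-> {n} {N} le = begin-strict
    (d + e) * ((d + e) * n)                ≤⟨ *-monoʳ-≤ (d + e) (*-monoʳ-≤ (d + e) (<⇒≤ (<-endpoint-suc-level n))) ⟩
    (d + e) * ((d + e) * endpoint (1 + i)) ≤⟨ *-monoʳ-≤ (d + e) (<⇒≤ (endpoint-suc-lower (1 + i))) ⟩
    (d + e) * (d * endpoint (2 + i))       ≡⟨ swap (d + e) d (endpoint (2 + i)) ⟩
    d * ((d + e) * endpoint (2 + i))       <⟨ *-monoʳ-< d (endpoint-suc-lower (2 + i)) ⟩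
    d * (d * endpoint (3 + i))             ≤⟨ *-monoʳ-≤ d (*-monoʳ-≤ d (endpoint-mono le)) ⟩
    d * (d * endpoint (level N))           ≤⟨ *-monoʳ-≤ d (*-monoʳ-≤ d (endpoint-level-≤ N)) ⟩
    d * (d * N)                            ∎
    where
    i = level n
    swap : ∀ b d a → b * (d * a) ≡ d * (b * a)
    swap = solve-∀

  -- If β n + 1 ≤ N ≤ β² n, the levels of n and N are incongruent modulo 3.
  separated : ∀ {n N} → (d + e) * n + d ≤ d * N →
              d * (d * N) ≤ (d + e) * ((d + e) * n) →
              level n % 3 ≢ level N % 3
  separated {n} {N} lower upper eq with level N ≤? level n
  ... | yes le = <⇒≱ (level-≤⇒ratio-< le) lower
  ... | no ¬le = <⇒≱ (3+level-≤⇒ratio-> (%-≡∧<⇒+≤ (level n) (level N) 3 eq (≰⇒> ¬le))) upper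

-- The ratio of (m + ℓ) y to ℓ y up to bounded error

module Ratio (m ℓ : ℕ) .{{_ : NonZero m}} .{{_ : NonZero ℓ}} where

  open ≤-Reasoning

  -- The surplus of (m + ℓ) y over β (ℓ y), multiplied by 2 ℓ, is ℓ m y ≥ y.
  ratio-lower : ∀ {n c y} → n ≤ ℓ * y + c → (2 * ℓ + m) * c + 2 * ℓ ≤ y →
                (2 * ℓ + m) * n + 2 * ℓ ≤ 2 * ℓ * ((m + ℓ) * y)
  ratio-lower {n} {c} {y} n≤ y-large = begin
    (2 * ℓ + m) * n + 2 * ℓ                              ≤⟨ +-monoˡ-≤ (2 * ℓ) (*-monoʳ-≤ (2 * ℓ + m) n≤) ⟩
    (2 * ℓ + m) * (ℓ * y + c) + 2 * ℓ                    ≡⟨ expand m ℓ y c ⟩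
    (2 * ℓ + m) * (ℓ * y) + ((2 * ℓ + m) * c + 2 * ℓ)    ≤⟨ +-monoʳ-≤ ((2 * ℓ + m) * (ℓ * y)) y-large ⟩
    (2 * ℓ + m) * (ℓ * y) + y                            ≤⟨ +-monoʳ-≤ ((2 * ℓ + m) * (ℓ * y)) (m≤n*m y (ℓ * m) {{m*n≢0 ℓ m}}) ⟩
    (2 * ℓ + m) * (ℓ * y) + ℓ * m * y                    ≡⟨ collect m ℓ y ⟩
    2 * ℓ * ((m + ℓ) * y)                                ∎
    where
    expand : ∀ m ℓ y c → (2 * ℓ + m) * (ℓ * y + c) + 2 * ℓ ≡ (2 * ℓ + m) * (ℓ * y) + ((2 * ℓ + m) * c + 2 * ℓ)
    expand = solve-∀
    collect : ∀ m ℓ y → (2 * ℓ + m) * (ℓ * y) + ℓ * m * y ≡ 2 * ℓ * ((m + ℓ) * y)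
    collect = solve-∀

  -- The surplus of β² (ℓ y) over (m + ℓ) y, multiplied by (2 ℓ)², is
  -- m² ℓ y ≥ y.
  ratio-upper : ∀ {n q y} → ℓ * y ≤ n + q → (2 * ℓ + m) * ((2 * ℓ + m) * q) ≤ y →
                2 * ℓ * (2 * ℓ * ((m + ℓ) * y)) ≤ (2 * ℓ + m) * ((2 * ℓ + m) * n)
  ratio-upper {n} {q} {y} ≤n+q y-large = +-cancelʳ-≤ (b * (b * q)) _ _ (begin
    2 * ℓ * (2 * ℓ * ((m + ℓ) * y)) + b * (b * q)        ≤⟨ +-monoʳ-≤ M y-large ⟩
    2 * ℓ * (2 * ℓ * ((m + ℓ) * y)) + y                  ≤⟨ +-monoʳ-≤ M (m≤n*m y (m * m * ℓ) {{m*n≢0 (m * m) ℓ {{m*n≢0 m m}}}}) ⟩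
    2 * ℓ * (2 * ℓ * ((m + ℓ) * y)) + m * m * ℓ * y      ≡⟨ collect m ℓ y ⟩
    b * (b * (ℓ * y))                                    ≤⟨ *-monoʳ-≤ b (*-monoʳ-≤ b ≤n+q) ⟩
    b * (b * (n + q))                                    ≡⟨ expand b n q ⟩
    b * (b * n) + b * (b * q)                            ∎)
    where
    b = 2 * ℓ + m
    M = 2 * ℓ * (2 * ℓ * ((m + ℓ) * y))
    collect : ∀ m ℓ y → 2 * ℓ * (2 * ℓ * ((m + ℓ) * y)) + m * m * ℓ * y ≡ (2 * ℓ + m) * ((2 * ℓ + m) * (ℓ * y))
    collect = solve-∀
    expand : ∀ b n q → b * (b * (n + q)) ≡ b * (b * n) + b * (b * q)
    expand = solve-∀

-- Integer shifts and infinite sets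

-- A shift by t adds p and removes q, where t = p - q.
shift : ∀ t → ∃[ p ] ∃[ q ] (∀ {n s} → + s ℤ.+ t ≡ + n → n + q ≡ s + p)
shift (+ p) = p , 0 , λ {n} eq → trans (+-identityʳ n) (sym (ℤ.+-injective eq))
shift t@(-[1+ q ]) = 0 , suc q , λ {n} {s} eq → ℤ.+-injective (begin
  + n ℤ.+ + suc q                ≡⟨ cong (ℤ._+ + suc q) eq ⟨
  + s ℤ.+ t ℤ.+ + suc q          ≡⟨ ℤ.+-assoc (+ s) t (+ suc q) ⟩
  + s ℤ.+ (t ℤ.+ + suc q)        ≡⟨ cong (λ k → + s ℤ.+ k) (ℤ.+-inverseˡ (+ suc q)) ⟩
  + s ℤ.+ + 0                    ∎)
  where open ≡-Reasoning

-- Inf is a negation, so elements of B exist only up to double negation; that is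
-- enough for refuting monochromaticity.
Inf⇒¬¬∃≥ : ∀ {B : Pred ℕ 0ℓ} → Inf B → ∀ i → ¬ ¬ (∃[ j ] (i ≤ j × B j))
Inf⇒¬¬∃≥ inf i none = inf (i , λ j i≤j Bj → none (j , i≤j , Bj))

Positive⇒∃suc : ∀ {z} → Positive z → ∃[ n ] (z ≡ + suc n)
Positive⇒∃suc {+ suc n} _ = n , refl

proposition5p1 : (m ℓ : ℕ) .{{_ : NonZero m}} .{{_ : NonZero ℓ}} →
    Σ[ χ ∈ Coloring 3 ] ((B : Pred ℕ 0ℓ) → B ⊆ NonZero → Inf B → (t : ℤ) →
    Pattern m ℓ B t ⊆ Positive → ¬ Monochromatic χ (Pattern m ℓ B t))
proposition5p1 m ℓ = (λ n → level n mod 3) , λ B B⊆NonZero inf t positive mono →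
  witness inf λ (x , Bx) →
  let
    (p , q , shifted) = shift t
    c = m * x + p
    b = 2 * ℓ + m
    -- y has to exceed x and the thresholds of both ratio estimates.
    lower-threshold = b * c + 2 * ℓ
    upper-threshold = b * (b * q)
  in
  Inf⇒¬¬∃≥ inf (suc x + (lower-threshold + upper-threshold)) λ (y , y-large , By) →
  let
    x<y = m+n≤o⇒m≤o (suc x) y-large
    thresholds = m+n≤o⇒n≤o (suc x) y-large
    in-pattern = inj₂ (x , y , Bx , By , x<y , refl)
    (k , z≡n) = Positive⇒∃suc (positive in-pattern)
    n = suc k
    N = (m + ℓ) * y
    n+q≡ : n + q ≡ ℓ * y + c
    n+q≡ = trans (shifted z≡n) (rearrange m ℓ x y p)
    instance
      y≢0 : NonZero y
      y≢0 = B⊆NonZero By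
      N≢0 : NonZero N
      N≢0 = m*n≢0 (m + ℓ) y
    same-colour = mono n N (subst (Pattern m ℓ B t) z≡n in-pattern) (inj₁ (y , By , refl))
  in
  separated
    (ratio-lower {n} {c} {y} (≤-trans (m≤m+n n q) (≤-reflexive n+q≡)) (m+n≤o⇒m≤o lower-threshold thresholds))
    (ratio-upper {n} {q} {y} (≤-trans (m≤m+n (ℓ * y) c) (≤-reflexive (sym n+q≡))) (m+n≤o⇒n≤o lower-threshold thresholds))
    (mod-≡⇒%-≡ (level n) (level N) 3 same-colour)
  where
  instance
    2ℓ≢0 : NonZero (2 * ℓ)
    2ℓ≢0 = m*n≢0 2 ℓ
    m+ℓ≢0 : NonZero (m + ℓ)
    m+ℓ≢0 = >-nonZero (m≤n⇒m≤n+o ℓ (>-nonZero⁻¹ m))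
  open Intervals m (2 * ℓ)
  open Ratio m ℓ
  rearrange : ∀ m ℓ x y p → m * x + ℓ * y + p ≡ ℓ * y + (m * x + p)
  rearrange = solve-∀
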